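{- Let $T$ be a finite tree of order $n(T)\ge 3$ and let $q$ be a positive integer such that $T$ is $q$-critical. Then $1\le q\le n(T)-1$. Moreover, both bounds are tight: there exists a tree of order at least $3$ which is $1$-critical, and there exists a tree $T$ of order at least $3$ which is $(n(T)-1)$-critical.
   Context: All graphs are finite and simple; $n(G)$ is the number of vertices of $G$. A set $D\subseteq V(G)$ is dominating if every vertex of $V(G)\setminus D$ has a neighbour in $D$; $\gamma(G)$ is the minimum cardinality of a dominating set of $G$. For $F\subseteq E(G)$, $G_F$ denotes the graph obtained from $G$ by subdividing each edge of $F$ exactly once (each edge $uv\in F$ is replaced by a path $u,w,v$ with a new vertex $w$). For an integer $q\ge 1$, a connected graph $G$ of order at least $3$ is called $q$-critical ($\gamma$-$q$-critical) if $\gamma(G_F)>\gamma(G)$ for every $F\subseteq E(G)$ with $|F|=q$, and there is a set $F'\subseteq E(G)$ with $|F'|=q-1$ such that $\gamma(G_{F'})=\gamma(G)$ (so $q$ is the smallest number such that subdividing any $q$ edges necessarily increases the domination number). -}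

module Defs where

open import Data.Empty using (⊥)
open import Data.Fin using (Fin; zero; suc; inject₁; fromℕ; splitAt; _<_)
open import Data.Fin.Properties using (_≟_; any?; all?)
open import Data.Fin.Subset using (Subset; _∈_; _∉_; ∣_∣; ⊤)
open import Data.Fin.Subset.Properties using (_∈?_; ∈⊤; anySubset?)
open import Data.List using (List; length; lookup)
open import Data.List.Relation.Unary.All using (All)
open import Data.List.Relation.Unary.Unique.Propositional using (Unique)
import Data.List.Membership.DecPropositional as DecMembership
import Data.List.Membership.Propositional as Membership
open import Data.Nat as ℕ using (ℕ; _+_; _∸_; _≤_; _>_)
open import Data.Nat.Induction using (<-wellFounded)
open import Data.Nat.Properties using (_<?_; ≮⇒≥)
open import Data.Product using (∃; _×_; _,_; proj₁; proj₂)
open import Data.Product.Properties using (≡-dec)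
open import Data.Sum using (_⊎_; inj₁; inj₂; swap)
open import Function using (_∘_)
open import Function.Definitions using (Injective)
open import Induction.WellFounded using (Acc; acc)
open import Level using (0ℓ)
open import Relation.Binary using (Rel; Decidable; Symmetric)
open import Relation.Binary.Construct.Closure.ReflexiveTransitive using (Star)
open import Relation.Binary.PropositionalEquality using (_≡_)
open import Relation.Nullary using (Dec; yes; no; ¬_; ¬?; contradiction)
open import Relation.Nullary.Decidable using (_×-dec_; _⊎-dec_; _→-dec_)
import Relation.Unary as U

-- Finite simple graphs, with vertex set Fin order.
record Graph : Set₁ where
  field
    order  : ℕ
    Adj    : Rel (Fin order) 0ℓ
    adj?   : Decidable Adj
    sym    : Symmetric Adj
    irrefl : ∀ {v} → ¬ Adj v v

  Vertex : Set
  Vertex = Fin order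

open Graph public using (order; Vertex)

Connected : Graph → Set
Connected G = ∀ u v → Star (Graph.Adj G) u v

-- A cycle c₀, c₁, …, c_{m+2}, c₀ of length m + 3, i.e. of arbitrary length ≥ 3.
record Cycle (G : Graph) : Set where
  open Graph G using (Adj)
  field
    {m}      : ℕ
    vertex   : Fin (3 + m) → Vertex G
    distinct : Injective _≡_ _≡_ vertex
    step     : ∀ (i : Fin (2 + m)) → Adj (vertex (inject₁ i)) (vertex (suc i))
    close    : Adj (vertex (fromℕ (2 + m))) (vertex zero)

IsTree : Graph → Set
IsTree G = Connected G × ¬ Cycle G

Dominating : (G : Graph) → Subset (order G) → Set
Dominating G D = ∀ v → v ∉ D → ∃ λ u → u ∈ D × Graph.Adj G v u

dominating? : ∀ G → U.Decidable (Dominating G)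
dominating? G D =
  all? λ v → ¬? (v ∈? D) →-dec any? λ u → (u ∈? D) ×-dec Graph.adj? G v u

IsMinimumDominating : (G : Graph) → Subset (order G) → Set
IsMinimumDominating G D =
  Dominating G D × (∀ D′ → Dominating G D′ → ∣ D ∣ ≤ ∣ D′ ∣)

minimumDominating : ∀ G → ∃ (IsMinimumDominating G)
minimumDominating G =
  descend ⊤ (λ v v∉⊤ → contradiction ∈⊤ v∉⊤) (<-wellFounded ∣ ⊤ {order G} ∣)
  where
  descend : ∀ D → Dominating G D → Acc ℕ._<_ ∣ D ∣ → ∃ (IsMinimumDominating G)
  descend D dom (acc rs)
    with anySubset? (λ D′ → dominating? G D′ ×-dec (∣ D′ ∣ <? ∣ D ∣))
  ... | yes (D′ , dom′ , D′<D) = descend D′ dom′ (rs D′<D)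
  ... | no none = D , dom , λ D′ dom′ → ≮⇒≥ λ D′<D → none (D′ , dom′ , D′<D)

γ : Graph → ℕ
γ G = ∣ proj₁ (minimumDominating G) ∣

-- A set F ⊆ E(G), given by listing its edges without repetition; the edge uv
-- appears as the pair (u , v) with u < v.
record EdgeSet (G : Graph) : Set where
  open Graph G using (Adj)
  field
    edges  : List (Vertex G × Vertex G)
    unique : Unique edges
    valid  : All (λ (u , v) → u < v × Adj u v) edges

  card : ℕ
  card = length edges

  Contains : Rel (Vertex G) 0ℓ
  Contains u v = (u , v) Membership.∈ edges ⊎ (v , u) Membership.∈ edges

  contains? : Decidable Contains
  contains? u v = ((u , v) ∈ₑ? edges) ⊎-dec ((v , u) ∈ₑ? edges)
    where open DecMembership (≡-dec _≟_ _≟_) renaming (_∈?_ to _∈ₑ?_)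

open EdgeSet public using (card)

-- The graph G_F. Its first n(G) vertices are those of G; the k-th of the
-- remaining |F| vertices subdivides the k-th edge of F.
module Subdivision (G : Graph) (F : EdgeSet G) where
  open Graph G using (Adj; adj?; sym; irrefl)
  open EdgeSet F using (edges; Contains; contains?)

  End : Vertex G → Fin (card F) → Set
  End u k = u ≡ proj₁ (lookup edges k) ⊎ u ≡ proj₂ (lookup edges k)

  end? : ∀ u k → Dec (End u k)
  end? u k = (u ≟ _) ⊎-dec (u ≟ _)

  SubAdj : Rel (Vertex G ⊎ Fin (card F)) 0ℓ
  SubAdj (inj₁ u) (inj₁ v) = Adj u v × ¬ Contains u v
  SubAdj (inj₁ u) (inj₂ k) = End u k
  SubAdj (inj₂ k) (inj₁ u) = End u k
  SubAdj (inj₂ _) (inj₂ _) = ⊥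

  subAdj? : Decidable SubAdj
  subAdj? (inj₁ u) (inj₁ v) = adj? u v ×-dec ¬? (contains? u v)
  subAdj? (inj₁ u) (inj₂ k) = end? u k
  subAdj? (inj₂ k) (inj₁ u) = end? u k
  subAdj? (inj₂ _) (inj₂ _) = no λ ()

  subSym : Symmetric SubAdj
  subSym {inj₁ u} {inj₁ v} (uv , uv∉F) = sym uv , uv∉F ∘ swap
  subSym {inj₁ u} {inj₂ k} e = e
  subSym {inj₂ k} {inj₁ u} e = e

  subIrrefl : ∀ {x} → ¬ SubAdj x x
  subIrrefl {inj₁ u} (uu , _) = irrefl uu

  subdivide : Graph
  subdivide = record
    { order  = order G + card F
    ; Adj    = λ x y → SubAdj (splitAt (order G) x) (splitAt (order G) y)
    ; adj?   = λ x y → subAdj? (splitAt (order G) x) (splitAt (order G) y)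
    ; sym    = λ {x} {y} → subSym {splitAt (order G) x} {splitAt (order G) y}
    ; irrefl = λ {x} → subIrrefl {splitAt (order G) x}
    }

open Subdivision public using (subdivide)

-- Meaningful for q ≥ 1 only, because of the truncated q ∸ 1.
record Critical (G : Graph) (q : ℕ) : Set where
  field
    connected : Connected G
    order≥3   : 3 ≤ order G
    increases : ∀ (F : EdgeSet G) → card F ≡ q → γ (subdivide G F) > γ G
    sharp     : ∃ λ (F′ : EdgeSet G) →
                  card F′ ≡ q ∸ 1 × γ (subdivide G F′) ≡ γ G

{-# OPTIONS --safe #-}
-- Let D be a minimum dominating set of the graph obtained from a connected
-- graph G of order ≥ 3 by subdividing all edges, A its original vertices and B
-- the subdivision vertices in it. Original vertices outside A are dominated by
-- B, so replacing each vertex of B by an end of its edge turns D into a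
-- dominating set of G. One element can be saved: if a ∈ A has a neighbour v,
-- then a may be dropped once v is present, and v is in A or is an end of an
-- edge in B; if A is empty, then B is everything, and two edges with a common
-- vertex may both be replaced by it. Hence γ increases when all edges are
-- subdivided. As n − 1 edges are all the edges of a tree, q ≤ n − 1. The paths
-- P₃ and P₄ attain the bounds.
module Submission where

open import Defs
open import Data.Fin as Fin using (Fin; zero; suc; inject₁; fromℕ; toℕ; _↑ˡ_; _↑ʳ_; splitAt; punchIn; punchOut)
open import Data.Fin.Induction using (<-weakInduction)
open import Data.Fin.Properties using (_≟_; any?; all?; <-cmp; <-asym; suc-injective; toℕ-inject₁; punchInᵢ≢i; punchIn-injective; punchIn-punchOut; injective⇒≤; splitAt-↑ˡ; splitAt-↑ʳ; splitAt⁻¹-↑ˡ; splitAt⁻¹-↑ʳ; ↑ˡ-injective; ↑ʳ-injective)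
open import Data.Fin.Subset using (Subset; inside; outside; _∈_; _∉_; ∣_∣; ⊤; ⊥; ⁅_⁆; _∪_; _-_)
open import Data.Fin.Subset.Properties using (_∈?_; ∈⊤; ∣⊤∣≡n; ∣⊥∣≡0; ∣⁅x⁆∣≡1; x∈⁅x⁆; x∈p∪q⁺; x∈p∧x≢y⇒x∈p-y; x∈p⇒∣p-x∣<∣p∣)
open import Data.List using (List; []; _∷_; length; lookup)
open import Data.List.Membership.Propositional using () renaming (_∈_ to _∈ₗ_)
open import Data.List.Membership.Propositional.Properties using (∈-lookup)
open import Data.List.Relation.Unary.All as All using (All; []; _∷_)
open import Data.List.Relation.Unary.All.Properties using (¬Any⇒All¬; All¬⇒¬Any)
open import Data.List.Relation.Unary.AllPairs using ([]; _∷_)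
open import Data.List.Relation.Unary.Any using (here; there; index)
open import Data.List.Relation.Unary.Any.Properties using (lookup-index)
open import Data.List.Relation.Unary.Unique.Propositional using (Unique)
open import Data.Nat using (ℕ; zero; suc; _+_; _∸_; _≤_; _<_; z≤n; s≤s)
import Data.Nat.Properties as ℕ
open import Data.Product using (Σ; ∃; ∃₂; _×_; _,_; proj₁; proj₂)
open import Data.Sum using (_⊎_; inj₁; inj₂; [_,_]; swap)
import Data.Sum as Sum
open import Data.Unit using (tt)
import Data.Vec as Vec
open import Data.Vec.Functional using () renaming (_∷_ to _◂_)
open import Function using (id; _∘_; _$_)
open import Function.Definitions using (Injective)
open import Level using (0ℓ)
open import Relation.Binary using (Rel; tri<; tri≈; tri>)
open import Relation.Binary.Construct.Closure.ReflexiveTransitive as Star using (Star; ε; _◅_; _◅◅_)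
open import Relation.Binary.PropositionalEquality using (_≡_; _≢_; refl; sym; trans; cong; subst)
open import Relation.Nullary using (Dec; yes; no; ¬_; ¬?; contradiction)
open import Relation.Nullary.Decidable using (_×-dec_; _⊎-dec_; _→-dec_; toWitness; decidable-stable)
open import Relation.Unary using (Pred; Decidable)

-- Acyclic graphs have fewer edges than vertices

record SimplePath {n} (R : Rel (Fin n) 0ℓ) (x y : Fin n) : Set where
  field
    {len}    : ℕ
    vertex   : Fin (suc len) → Fin n
    distinct : Injective _≡_ _≡_ vertex
    step     : ∀ i → R (vertex (inject₁ i)) (vertex (suc i))
    start    : vertex zero ≡ x
    end      : vertex (fromℕ len) ≡ y

module _ {n} {R : Rel (Fin n) 0ℓ} where

  suffix : ∀ {len} (w : Fin (suc len) → Fin n) → Injective _≡_ _≡_ w →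
           (∀ i → R (w (inject₁ i)) (w (suc i))) →
           ∀ i → SimplePath R (w i) (w (fromℕ len))
  suffix w inj st zero = record
    { vertex = w ; distinct = inj ; step = st ; start = refl ; end = refl }
  suffix {suc len} w inj st (suc i) =
    suffix (w ∘ suc) (suc-injective ∘ inj) (st ∘ suc) i

  -- If `x` already occurs on the path, everything before that occurrence is cut off; this keeps the
  -- vertices distinct.
  prepend : ∀ {x y z} → R x y → SimplePath R y z → SimplePath R x z
  prepend {x} Rxy record { vertex = w ; distinct = inj ; step = st ; start = refl ; end = refl }
    with any? (λ i → w i ≟ x)
  ... | yes (i , refl) = suffix w inj st i
  ... | no x∉w = record
    { vertex   = x ◂ w
    ; distinct = distinct
    ; step     = λ { zero → Rxy ; (suc i) → st i }
    ; start    = refl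
    ; end      = refl
    }
    where
    distinct : Injective _≡_ _≡_ (x ◂ w)
    distinct {zero}  {zero}  _ = refl
    distinct {zero}  {suc j} e = contradiction (j , sym e) x∉w
    distinct {suc i} {zero}  e = contradiction (i , e) x∉w
    distinct {suc i} {suc j} e = cong suc (inj e)

  trivial : ∀ {x} → SimplePath R x x
  trivial {x} = record
    { len      = 0
    ; vertex   = λ _ → x
    ; distinct = λ { {zero} {zero} _ → refl }
    ; step     = λ ()
    ; start    = refl
    ; end      = refl
    }

  simplePath : ∀ {x y} → Star R x y → SimplePath R x y
  simplePath = Star.fold (SimplePath R) prepend trivial

module _ (G : Graph) where
  open Graph G using (Adj)

  -- A path from `u` to `v` of length 0 would make `uv` a loop, and one of length 1 would be the
  -- excluded step `R u v`. Any longer one is closed into a cycle by `uv`.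
  closePath : ∀ {R : Rel (Vertex G) 0ℓ} {u v} → (∀ {x y} → R x y → Adj x y) →
              Adj u v → ¬ R u v → SimplePath R u v → Cycle G
  closePath R⇒Adj uv ¬Ruv record { len = 0 ; start = refl ; end = refl } =
    contradiction uv (Graph.irrefl G)
  closePath R⇒Adj uv ¬Ruv record { len = 1 ; step = st ; start = refl ; end = refl } =
    contradiction (st zero) ¬Ruv
  closePath R⇒Adj uv ¬Ruv
    record { len = suc (suc m) ; vertex = w ; distinct = inj ; step = st ; start = refl ; end = refl } =
    record { vertex = w ; distinct = inj ; step = R⇒Adj ∘ st ; close = Graph.sym G uv }

  Joined : List (Vertex G × Vertex G) → Rel (Vertex G) 0ℓ
  Joined L x y = (x , y) ∈ₗ L ⊎ (y , x) ∈ₗ L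

  Oriented : Vertex G × Vertex G → Set
  Oriented (u , v) = u Fin.< v × Adj u v

  joined⇒adj : ∀ {L x y} → All Oriented L → Joined L x y → Adj x y
  joined⇒adj valid (inj₁ xy∈L) = proj₂ (All.lookup valid xy∈L)
  joined⇒adj valid (inj₂ yx∈L) = Graph.sym G (proj₂ (All.lookup valid yx∈L))

  -- In an acyclic graph every further edge joins two components, which costs one
  -- representative.
  record Components (L : List (Vertex G × Vertex G)) : Set where
    field
      rep   : Vertex G → Vertex G
      reach : ∀ x → Star (Joined L) x (rep x)
      reps  : Subset (order G)
      rep∈  : ∀ x → rep x ∈ reps
      count : length L + ∣ reps ∣ ≤ order G

  module _ (acyclic : ¬ Cycle G) where

    components : ∀ {L} → Unique L → All Oriented L → Components L
    components [] [] = record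
      { rep   = id
      ; reach = λ _ → ε
      ; reps  = ⊤
      ; rep∈  = λ _ → ∈⊤
      ; count = ℕ.≤-reflexive (∣⊤∣≡n (order G))
      }
    components {(u , v) ∷ L} (uv∉L ∷ unique) ((u<v , uv) ∷ valid) = record
      { rep = rep′ ; reach = reach′ ; reps = reps - rep u ; rep∈ = rep′∈ ; count = count′ }
      where
      open Components (components unique valid)

      rep-u≢rep-v : rep u ≢ rep v
      -- Equal representatives would join `u` to `v` inside `L`, and the new edge would close a
      -- cycle.
      rep-u≢rep-v eq = acyclic $ closePath (joined⇒adj valid) uv ¬joined $ simplePath $
        reach u ◅◅ subst (λ x → Star (Joined L) x v) (sym eq) (Star.reverse swap (reach v))
        where
        ¬joined : ¬ Joined L u v
        ¬joined (inj₁ uv∈L) = All¬⇒¬Any uv∉L uv∈L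
        ¬joined (inj₂ vu∈L) = <-asym u<v (proj₁ (All.lookup valid vu∈L))

      -- The component of `u` adopts the representative of `v`, which frees `rep u` for deletion.
      rep′ : Vertex G → Vertex G
      rep′ x with rep x ≟ rep u
      ... | yes _ = rep v
      ... | no _  = rep x

      weaken : ∀ {x y} → Star (Joined L) x y → Star (Joined ((u , v) ∷ L)) x y
      weaken = Star.map (Sum.map there there)

      reach′ : ∀ x → Star (Joined ((u , v) ∷ L)) x (rep′ x)
      reach′ x with rep x ≟ rep u
      ... | no _   = weaken (reach x)
      ... | yes eq =
        weaken (reach x ◅◅ subst (λ y → Star (Joined L) y u) (sym eq) (Star.reverse swap (reach u)))
        ◅◅ inj₁ (here refl) ◅ weaken (reach v)

      rep′∈ : ∀ x → rep′ x ∈ reps - rep u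
      rep′∈ x with rep x ≟ rep u
      ... | yes _ = x∈p∧x≢y⇒x∈p-y (rep∈ v) (rep-u≢rep-v ∘ sym)
      ... | no ≢  = x∈p∧x≢y⇒x∈p-y (rep∈ x) ≢

      count′ : suc (length L) + ∣ reps - rep u ∣ ≤ order G
      count′ = begin
        suc (length L) + ∣ reps - rep u ∣ ≡⟨ ℕ.+-suc (length L) _ ⟨
        length L + suc ∣ reps - rep u ∣   ≤⟨ ℕ.+-monoʳ-≤ (length L) (x∈p⇒∣p-x∣<∣p∣ (rep∈ u)) ⟩
        length L + ∣ reps ∣               ≤⟨ count ⟩
        order G                           ∎
        where open ℕ.≤-Reasoning

    -- The vertex `v` makes the set of representatives nonempty, hence the strict inequality.
    acyclic⇒edges<order : Vertex G → (F : EdgeSet G) → card F < order G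
    acyclic⇒edges<order v F = begin-strict
      card F             ≡⟨ ℕ.+-identityʳ _ ⟨
      card F + 0         <⟨ ℕ.+-monoʳ-< (card F) (ℕ.≤-<-trans z≤n (x∈p⇒∣p-x∣<∣p∣ (rep∈ v))) ⟩
      card F + ∣ reps ∣  ≤⟨ count ⟩
      order G            ∎
      where
      open ℕ.≤-Reasoning
      open Components (components (EdgeSet.unique F) (EdgeSet.valid F))

    -- Adding a missing edge to `F` would give at least `order G` edges, too many for an acyclic
    -- graph.
    allEdges : Vertex G → (F : EdgeSet G) → order G ∸ 1 ≤ card F →
               ∀ {u v} → Adj u v → EdgeSet.Contains F u v
    allEdges r F n∸1≤F {u} {v} uv = decidable-stable (contains? u v) λ uv∉F →
      [ noExtra (uv∉F ∘ inj₁) , noExtra (uv∉F ∘ inj₂) ] (orient uv)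
      where
      open EdgeSet F using (edges; unique; valid; contains?)

      orient : ∀ {u v} → Adj u v → Oriented (u , v) ⊎ Oriented (v , u)
      orient {u} {v} uv with <-cmp u v
      ... | tri< u<v _ _  = inj₁ (u<v , uv)
      ... | tri≈ _ refl _ = contradiction uv (Graph.irrefl G)
      ... | tri> _ _ v<u  = inj₂ (v<u , Graph.sym G uv)

      noExtra : ∀ {e} → ¬ e ∈ₗ edges → ¬ Oriented e
      noExtra {e} e∉F oriented = ℕ.<-irrefl refl $ begin-strict
        suc (card F)      <⟨ acyclic⇒edges<order r F+e ⟩
        order G           ≤⟨ ℕ.m≤n+m∸n (order G) 1 ⟩
        suc (order G ∸ 1) ≤⟨ s≤s n∸1≤F ⟩
        suc (card F)      ∎
        where
        open ℕ.≤-Reasoning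
        F+e : EdgeSet G
        F+e = record
          { edges  = e ∷ edges
          ; unique = ¬Any⇒All¬ _ e∉F ∷ unique
          ; valid  = oriented ∷ valid
          }

-- Connected graphs

crossing : ∀ {A : Set} {R : Rel A 0ℓ} {P : Pred A 0ℓ} → Decidable P → ∀ {x y} →
           Star R x y → P x → ¬ P y → ∃₂ λ a b → R a b × P a × ¬ P b
crossing P? ε Px ¬Px = contradiction Px ¬Px
crossing P? {x} (_◅_ {j = y} Rxy y⟶z) Px ¬Pz with P? y
... | yes Py = crossing P? y⟶z Py ¬Pz
... | no ¬Py = x , y , Rxy , Px , ¬Py

another : ∀ {n} → 2 ≤ n → (a : Fin n) → ∃ λ b → b ≢ a
another (s≤s (s≤s _)) a = punchIn a zero , punchInᵢ≢i a zero

third : ∀ {n} → 3 ≤ n → {a b : Fin n} → a ≢ b → ∃ λ c → c ≢ a × c ≢ b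
third (s≤s (s≤s (s≤s _))) {a} {b} a≢b =
  punchIn a c , punchInᵢ≢i a c ,
  λ e → punchInᵢ≢i (punchOut a≢b) zero
          (punchIn-injective a _ _ (trans e (sym (punchIn-punchOut a≢b))))
  -- `punchOut a≢b` is the place of `b` once `a` is removed, so avoiding it means avoiding `b`.
  where c = punchIn (punchOut a≢b) zero

module _ (G : Graph) (connected : Connected G) where
  open Graph G using (Adj)

  neighbour : 2 ≤ order G → ∀ a → ∃ λ v → Adj a v
  neighbour 2≤n a with another 2≤n a
  ... | b , b≢a with crossing (_≟ a) (connected a b) refl b≢a
  ... | _ , v , av , refl , _ = v , av

  -- Take an edge `ax` and a third vertex `z`. A walk from `a` to `z` leaves the pair by an edge at
  -- `a` or at `x`, and that end is the common vertex.
  twoNeighbours : 3 ≤ order G → Vertex G → ∃ λ c → ∃₂ λ u w → u ≢ w × Adj c u × Adj c w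
  twoNeighbours 3≤n a with neighbour (ℕ.<⇒≤ 3≤n) a
  ... | x , ax with third 3≤n {a} {x} (λ { refl → Graph.irrefl G ax })
  ... | z , z≢a , z≢x
    with crossing (λ y → (y ≟ a) ⊎-dec (y ≟ x)) (connected a z) (inj₁ refl) [ z≢a , z≢x ]
  ... | _ , t , at , inj₁ refl , t≢ = a , x , t , (λ e → t≢ (inj₂ (sym e))) , ax , at
  ... | _ , t , xt , inj₂ refl , t≢ = x , a , t , (λ e → t≢ (inj₁ (sym e))) , Graph.sym G ax , xt

-- Subdividing all edges

∣p∪q∣≤∣p∣+∣q∣ : ∀ {n} (p q : Subset n) → ∣ p ∪ q ∣ ≤ ∣ p ∣ + ∣ q ∣
∣p∪q∣≤∣p∣+∣q∣ Vec.[] Vec.[] = z≤n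
∣p∪q∣≤∣p∣+∣q∣ (outside Vec.∷ p) (outside Vec.∷ q) = ∣p∪q∣≤∣p∣+∣q∣ p q
∣p∪q∣≤∣p∣+∣q∣ (outside Vec.∷ p) (inside Vec.∷ q) =
  ℕ.≤-trans (s≤s (∣p∪q∣≤∣p∣+∣q∣ p q)) (ℕ.≤-reflexive (sym (ℕ.+-suc ∣ p ∣ ∣ q ∣)))
∣p∪q∣≤∣p∣+∣q∣ (inside Vec.∷ p) (outside Vec.∷ q) = s≤s (∣p∪q∣≤∣p∣+∣q∣ p q)
∣p∪q∣≤∣p∣+∣q∣ (inside Vec.∷ p) (inside Vec.∷ q) =
  s≤s (ℕ.≤-trans (∣p∪q∣≤∣p∣+∣q∣ p q) (ℕ.+-monoʳ-≤ ∣ p ∣ (ℕ.n≤1+n ∣ q ∣)))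

image : ∀ {m n} → (Fin m → Fin n) → Subset m → Subset n
image f Vec.[]            = ⊥
image f (inside Vec.∷ p)  = ⁅ f zero ⁆ ∪ image (f ∘ suc) p
image f (outside Vec.∷ p) = image (f ∘ suc) p

∈-image : ∀ {m n} (f : Fin m → Fin n) (p : Subset m) {x} → x ∈ p → f x ∈ image f p
∈-image f (inside Vec.∷ p)  Vec.here        = x∈p∪q⁺ (inj₁ (x∈⁅x⁆ _))
∈-image f (inside Vec.∷ p)  (Vec.there x∈p) = x∈p∪q⁺ (inj₂ (∈-image (f ∘ suc) p x∈p))
∈-image f (outside Vec.∷ p) (Vec.there x∈p) = ∈-image (f ∘ suc) p x∈p

∣image∣≤∣p∣ : ∀ {m n} (f : Fin m → Fin n) (p : Subset m) → ∣ image f p ∣ ≤ ∣ p ∣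
∣image∣≤∣p∣ {n = n} f Vec.[] = ℕ.≤-reflexive (∣⊥∣≡0 n)
∣image∣≤∣p∣ f (outside Vec.∷ p) = ∣image∣≤∣p∣ (f ∘ suc) p
∣image∣≤∣p∣ f (inside Vec.∷ p) = begin
  ∣ ⁅ f zero ⁆ ∪ image (f ∘ suc) p ∣        ≤⟨ ∣p∪q∣≤∣p∣+∣q∣ ⁅ f zero ⁆ _ ⟩
  ∣ ⁅ f zero ⁆ ∣ + ∣ image (f ∘ suc) p ∣    ≡⟨ cong (_+ ∣ image (f ∘ suc) p ∣) (∣⁅x⁆∣≡1 (f zero)) ⟩
  suc ∣ image (f ∘ suc) p ∣                 ≤⟨ s≤s (∣image∣≤∣p∣ (f ∘ suc) p) ⟩
  suc ∣ p ∣                                 ∎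
  where open ℕ.≤-Reasoning

γ-lowerBound : ∀ G {D} → Dominating G D → γ G ≤ ∣ D ∣
γ-lowerBound G = proj₂ (proj₂ (minimumDominating G)) _

module _ (G : Graph) where
  open Graph G using (Adj)

  -- The image of `D - y` still dominates `G`; strictness comes from the deleted `y`.
  γ<-byImage : ∀ {m} (D : Subset m) (h : Fin m → Vertex G) {y} → y ∈ D →
               (∀ v → ∃ λ x → x ∈ D × x ≢ y × (v ≡ h x ⊎ Adj v (h x))) →
               γ G < ∣ D ∣
  γ<-byImage D h {y} y∈D dominated = begin-strict
    γ G                    ≤⟨ γ-lowerBound G image-dominating ⟩
    ∣ image h (D - y) ∣    ≤⟨ ∣image∣≤∣p∣ h (D - y) ⟩
    ∣ D - y ∣              <⟨ x∈p⇒∣p-x∣<∣p∣ y∈D ⟩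
    ∣ D ∣                  ∎
    where
    open ℕ.≤-Reasoning
    image-dominating : Dominating G (image h (D - y))
    image-dominating v v∉ with dominated v
    ... | x , x∈D , x≢y , v~hx with ∈-image h (D - y) (x∈p∧x≢y⇒x∈p-y x∈D x≢y) | v~hx
    ... | hx∈ | inj₁ refl = contradiction hx∈ v∉
    ... | hx∈ | inj₂ adj  = h x , hx∈ , adj

-- Dominating sets after subdividing every edge

module _ (G : Graph) (F : EdgeSet G)
         (full : ∀ {u v} → Graph.Adj G u v → EdgeSet.Contains F u v) where
  open Graph G using (Adj)
  open EdgeSet F using (edges; valid; Contains)
  open Subdivision G F using (End)

  private
    n = order G
    m = card F

  adj⇒≢ : ∀ {u v} → Adj u v → u ≢ v
  adj⇒≢ uv refl = Graph.irrefl G uv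

  ends-adjacent : ∀ {u w k} → End u k → End w k → u ≡ w ⊎ Adj u w
  ends-adjacent (inj₁ refl) (inj₁ refl) = inj₁ refl
  ends-adjacent {k = k} (inj₁ refl) (inj₂ refl) = inj₂ (proj₂ (All.lookup valid (∈-lookup k)))
  ends-adjacent {k = k} (inj₂ refl) (inj₁ refl) =
    inj₂ (Graph.sym G (proj₂ (All.lookup valid (∈-lookup k))))
  ends-adjacent (inj₂ refl) (inj₂ refl) = inj₁ refl

  edgeOf : ∀ {u v} → Adj u v → ∃ λ k → End u k × End v k
  edgeOf uv with full uv
  ... | inj₁ uv∈F = let e = lookup-index uv∈F in
    index uv∈F , inj₁ (cong proj₁ e) , inj₂ (cong proj₂ e)
  ... | inj₂ vu∈F = let e = lookup-index vu∈F in
    index vu∈F , inj₂ (cong proj₂ e) , inj₁ (cong proj₁ e)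

  otherEnd-unique : ∀ {c u w k} → End c k → End u k → End w k → c ≢ u → c ≢ w → u ≡ w
  otherEnd-unique (inj₁ refl) (inj₁ refl) _           c≢u _   = contradiction refl c≢u
  otherEnd-unique (inj₁ refl) (inj₂ refl) (inj₁ refl) _   c≢w = contradiction refl c≢w
  otherEnd-unique (inj₁ refl) (inj₂ refl) (inj₂ refl) _   _   = refl
  otherEnd-unique (inj₂ refl) (inj₁ refl) (inj₁ refl) _   _   = refl
  otherEnd-unique (inj₂ refl) (inj₁ refl) (inj₂ refl) _   c≢w = contradiction refl c≢w
  otherEnd-unique (inj₂ refl) (inj₂ refl) _           c≢u _   = contradiction refl c≢u

  -- This map carries dominating sets of the subdivided graph back to `G`; it is used with `c k` an
  -- end of the edge `k`.
  collapse : (Fin m → Vertex G) → Fin (n + m) → Vertex G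
  collapse c = [ id , c ] ∘ splitAt n

  -- Prescribing the end at one edge puts a wanted vertex into the image; at all other edges the
  -- choice is arbitrary.
  chooseEnds : ∀ {t k₀} → End t k₀ → ∃ λ (c : Fin m → Vertex G) → (∀ k → End (c k) k) × c k₀ ≡ t
  chooseEnds {t} {k₀} t∈k₀ = c , c-end , c-k₀
    where
    c : Fin m → Vertex G
    c k with k ≟ k₀
    ... | yes _ = t
    ... | no _  = proj₁ (lookup edges k)

    c-end : ∀ k → End (c k) k
    c-end k with k ≟ k₀
    ... | yes refl = t∈k₀
    ... | no _     = inj₁ refl

    c-k₀ : c k₀ ≡ t
    c-k₀ with k₀ ≟ k₀
    ... | yes _ = refl
    ... | no ≢  = contradiction refl ≢

  old≢new : ∀ {v k} → v ↑ˡ m ≢ n ↑ʳ k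
  old≢new {v} {k} e
    with trans (sym (splitAt-↑ˡ n v m)) (trans (cong (splitAt n) e) (splitAt-↑ʳ n m k))
  ... | ()

  module _ {D : Subset (n + m)} (dominating : Dominating (subdivide G F) D) where

    -- As `F` contains every edge, no two original vertices remain adjacent.
    old-dominated : ∀ {v} → v ↑ˡ m ∉ D → ∃ λ k → n ↑ʳ k ∈ D × End v k
    old-dominated {v} v∉D with dominating (v ↑ˡ m) v∉D
    ... | x , x∈D , vx rewrite splitAt-↑ˡ n v m with splitAt n x in eq | vx
    ... | inj₁ u | vu , vu∉F = contradiction (full vu) vu∉F
    ... | inj₂ k | v∈k       = k , subst (_∈ D) (sym (splitAt⁻¹-↑ʳ eq)) x∈D , v∈k

    new-dominated : ∀ {k} → n ↑ʳ k ∉ D → ∃ λ u → u ↑ˡ m ∈ D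
    new-dominated {k} k∉D with dominating (n ↑ʳ k) k∉D
    ... | x , x∈D , kx rewrite splitAt-↑ʳ n m k with splitAt n x in eq | kx
    ... | inj₁ u | _ = u , subst (_∈ D) (sym (splitAt⁻¹-↑ˡ eq)) x∈D

    module _ {c : Fin m → Vertex G} (c-end : ∀ k → End (c k) k) where

      -- The vertex `y` is the one to be dropped: this is the condition of `γ<-byImage` at `v`, for
      -- the map `collapse c`.
      dominatedBy : (y : Fin (n + m)) → Vertex G → Set
      dominatedBy y v = ∃ λ x → x ∈ D × x ≢ y × (v ≡ collapse c x ⊎ Adj v (collapse c x))

      byOld : ∀ {y v u} → u ↑ˡ m ∈ D → u ↑ˡ m ≢ y → v ≡ u ⊎ Adj v u → dominatedBy y v
      byOld {u = u} u∈D u≢y v~u =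
        u ↑ˡ m , u∈D , u≢y ,
        subst (λ z → _ ≡ z ⊎ Adj _ z) (sym (cong [ id , c ] (splitAt-↑ˡ n u m))) v~u

      byNew : ∀ {y v k} → n ↑ʳ k ∈ D → n ↑ʳ k ≢ y → v ≡ c k ⊎ Adj v (c k) → dominatedBy y v
      byNew {k = k} k∈D k≢y v~ck =
        n ↑ʳ k , k∈D , k≢y ,
        subst (λ z → _ ≡ z ⊎ Adj _ z) (sym (cong [ id , c ] (splitAt-↑ʳ n m k))) v~ck

      -- Only `a` can suffer from the loss. Any other original vertex lies in `D` or is an end of an
      -- edge subdivided by an element of `D`, hence equal or adjacent to the chosen end.
      γ<-dropOld : ∀ {a} → a ↑ˡ m ∈ D → dominatedBy (a ↑ˡ m) a → γ G < ∣ D ∣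
      γ<-dropOld {a} a∈D a-dominated = γ<-byImage G D (collapse c) a∈D others
        where
        others : ∀ v → dominatedBy (a ↑ˡ m) v
        others v with v ≟ a
        ... | yes refl = a-dominated
        ... | no v≢a with (v ↑ˡ m) ∈? D
        ...   | yes v∈D = byOld v∈D (v≢a ∘ ↑ˡ-injective m v a) (inj₁ refl)
        ...   | no v∉D with old-dominated v∉D
        ...     | k , k∈D , v∈k = byNew k∈D (old≢new ∘ sym) (ends-adjacent v∈k (c-end k))

    -- The neighbour `v` takes over the domination of `a`: it lies in `D`, or it can be chosen as
    -- the end that replaces a subdivision vertex in `D`.
    γ<-someOld : ∀ {a v} → a ↑ˡ m ∈ D → Adj a v → γ G < ∣ D ∣
    γ<-someOld {a} {v} a∈D av with (v ↑ˡ m) ∈? D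
    ... | yes v∈D = γ<-dropOld firstEnd a∈D (byOld firstEnd v∈D (adj⇒≢ av ∘ sym ∘ ↑ˡ-injective m v a) (inj₂ av))
      where
      firstEnd : ∀ k → End (proj₁ (lookup edges k)) k
      firstEnd _ = inj₁ refl
    ... | no v∉D with old-dominated v∉D
    ...   | k , k∈D , v∈k with chooseEnds v∈k
    ...     | c , c-end , refl = γ<-dropOld c-end a∈D (byNew c-end k∈D (old≢new ∘ sym) (inj₂ av))

    γ<-noOld : (∀ v → v ↑ˡ m ∉ D) → ∀ {c u w} → u ≢ w → Adj c u → Adj c w → γ G < ∣ D ∣
    γ<-noOld none {c} {u} {w} u≢w cu cw with edgeOf cu | edgeOf cw
    ... | k , c∈k , u∈k | l , c∈l , w∈l with chooseEnds c∈k
    ... | f , f-end , refl = γ<-byImage G D (collapse f) (all∈D l) dominated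
      where
      all∈D : ∀ k → n ↑ʳ k ∈ D
      all∈D k = decidable-stable ((n ↑ʳ k) ∈? D) λ k∉D →
        let v , v∈D = new-dominated k∉D in none v v∈D

      new≢ : ∀ {i j} → i ≢ j → n ↑ʳ i ≢ n ↑ʳ j
      new≢ i≢j e = i≢j (↑ʳ-injective n _ _ e)

      k≢l : k ≢ l
      k≢l refl = u≢w (otherEnd-unique c∈k u∈k w∈l (adj⇒≢ cu) (adj⇒≢ cw))

      dominated : ∀ v → dominatedBy f-end (n ↑ʳ l) v
      dominated v with old-dominated (none v)
      ... | j , j∈D , v∈j with j ≟ l
      -- Both ends of the dropped edge `l` are equal or adjacent to `c`, which edge `k` contributes.
      ... | yes refl = byNew f-end (all∈D k) (new≢ k≢l) (ends-adjacent v∈j c∈l)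
      ... | no j≢l   = byNew f-end j∈D (new≢ j≢l) (ends-adjacent v∈j (f-end j))

  γ<γ-subdivideAll : Connected G → 3 ≤ n → Vertex G → γ G < γ (subdivide G F)
  -- Matching on the chosen minimum set turns `γ (subdivide G F)` into `∣ D ∣`.
  γ<γ-subdivideAll connected 3≤n r
    with minimumDominating (subdivide G F)
  ... | D , dominating , _ with any? (λ v → (v ↑ˡ m) ∈? D)
  ... | yes (a , a∈D) = γ<-someOld dominating a∈D (proj₂ (neighbour G connected (ℕ.<⇒≤ 3≤n) a))
  ... | no none with twoNeighbours G connected 3≤n r
  ... | c , u , w , u≢w , cu , cw = γ<-noOld dominating (λ v v∈D → none (v , v∈D)) u≢w cu cw

-- The upper bound for trees

someVertex : ∀ {n} → 3 ≤ n → Fin n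
someVertex (s≤s _) = zero

tree⇒γ<γ-subdivide : ∀ T → IsTree T → 3 ≤ order T → (F : EdgeSet T) →
                     order T ∸ 1 ≤ card F → γ T < γ (subdivide T F)
tree⇒γ<γ-subdivide T (connected , acyclic) 3≤n F n∸1≤F =
  γ<γ-subdivideAll T F (allEdges T acyclic (someVertex 3≤n) F n∸1≤F) connected 3≤n (someVertex 3≤n)

-- If `q` exceeded `order T ∸ 1`, the set of `q ∸ 1` edges that preserves `γ` would have at least
-- `order T ∸ 1` edges, and so would increase it.
critical⇒≤order∸1 : ∀ T → IsTree T → 3 ≤ order T → ∀ {q} → Critical T q → q ≤ order T ∸ 1
critical⇒≤order∸1 T tree 3≤n {q} critical with Critical.sharp critical
... | F , card-F , γ-same = ℕ.≮⇒≥ λ n∸1<q →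
  ℕ.<-irrefl (sym γ-same) $ tree⇒γ<γ-subdivide T tree 3≤n F $
  subst (order T ∸ 1 ≤_) (sym card-F) (ℕ.∸-monoˡ-≤ 1 n∸1<q)

-- Paths

pathGraph : ℕ → Graph
pathGraph n = record
  { order  = n
  ; Adj    = λ u v → toℕ u ≡ suc (toℕ v) ⊎ toℕ v ≡ suc (toℕ u)
  ; adj?   = λ u v → (toℕ u ℕ.≟ suc (toℕ v)) ⊎-dec (toℕ v ℕ.≟ suc (toℕ u))
  ; sym    = swap
  ; irrefl = [ ℕ.1+n≢n ∘ sym , ℕ.1+n≢n ∘ sym ]
  }

pathGraph-connected : ∀ n → Connected (pathGraph n)
pathGraph-connected (suc n) u v = toZero u ◅◅ Star.reverse swap (toZero v)
  where
  toZero : ∀ v → Star (Graph.Adj (pathGraph (suc n))) v zero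
  toZero = <-weakInduction _ ε λ i i⟶0 → inj₁ (cong suc (sym (toℕ-inject₁ i))) ◅ i⟶0

module _ (n : ℕ) where
  open Graph (pathGraph n)

  -- Phrased with vertices so that exhaustive search decides them; `SquareFree` must admit closed
  -- walks that backtrack.
  TriangleFree SquareFree : Set
  TriangleFree = ∀ a b c → ¬ (Adj a b × Adj b c × Adj c a)
  SquareFree   = ∀ a b c d → Adj a b × Adj b c × Adj c d × Adj d a → a ≡ c ⊎ b ≡ d

  triangleFree? : Dec TriangleFree
  triangleFree? = all? λ a → all? λ b → all? λ c →
    ¬? (adj? a b ×-dec adj? b c ×-dec adj? c a)

  squareFree? : Dec SquareFree
  squareFree? = all? λ a → all? λ b → all? λ c → all? λ d →
    (adj? a b ×-dec adj? b c ×-dec adj? c d ×-dec adj? d a) →-dec ((a ≟ c) ⊎-dec (b ≟ d))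

  -- On at most four vertices a cycle has length 3 or 4, and a longer one would need five distinct
  -- vertices.
  smallPath-acyclic : n ≤ 4 → TriangleFree → SquareFree → ¬ Cycle (pathGraph n)
  smallPath-acyclic _ triangleFree _ record { m = 0 ; step = st ; close = cl } =
    triangleFree _ _ _ (st zero , st (suc zero) , cl)
  smallPath-acyclic _ _ squareFree record { m = 1 ; distinct = inj ; step = st ; close = cl }
    with squareFree _ _ _ _ (st zero , st (suc zero) , st (suc (suc zero)) , cl)
  ... | inj₁ e = contradiction (inj e) λ ()
  ... | inj₂ e = contradiction (inj e) λ ()
  smallPath-acyclic n≤4 _ _ record { m = suc (suc _) ; distinct = inj }
    with ℕ.≤-trans (injective⇒≤ inj) n≤4
  ... | s≤s (s≤s (s≤s (s≤s ())))

-- Tightness of the bounds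

P₃ P₄ : Graph
P₃ = pathGraph 3
P₄ = pathGraph 4

P₃-tree : IsTree P₃
P₃-tree = pathGraph-connected 3 , smallPath-acyclic 3 (ℕ.n≤1+n 3)
  (toWitness {a? = triangleFree? 3} tt) (toWitness {a? = squareFree? 3} tt)

P₄-tree : IsTree P₄
P₄-tree = pathGraph-connected 4 , smallPath-acyclic 4 ℕ.≤-refl
  (toWitness {a? = triangleFree? 4} tt) (toWitness {a? = squareFree? 4} tt)

P₃-1-critical : Critical P₃ 1
P₃-1-critical = record
  { connected = proj₁ P₃-tree
  ; order≥3   = ℕ.≤-refl
  ; increases = increases
  ; sharp     = record { edges = [] ; unique = [] ; valid = [] } , refl , refl
  }
  where
  -- Subdividing either edge of `P₃` gives a path on four vertices, and `γ` rises from 1 to 2 by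
  -- computation. All other pairs are misordered or not adjacent.
  increases : ∀ F → card F ≡ 1 → γ P₃ < γ (subdivide P₃ F)
  increases record { edges = (zero , suc zero) ∷ [] } _ = ℕ.≤-refl
  increases record { edges = (suc zero , suc (suc zero)) ∷ [] } _ = ℕ.≤-refl
  increases record { edges = (zero , zero) ∷ [] ; valid = (() , _) ∷ [] } _
  increases record { edges = (zero , suc (suc zero)) ∷ [] ; valid = (_ , inj₁ ()) ∷ [] } _
  increases record { edges = (zero , suc (suc zero)) ∷ [] ; valid = (_ , inj₂ ()) ∷ [] } _
  increases record { edges = (suc zero , zero) ∷ [] ; valid = (() , _) ∷ [] } _
  increases record { edges = (suc zero , suc zero) ∷ [] ; valid = (s≤s () , _) ∷ [] } _
  increases record { edges = (suc (suc zero) , zero) ∷ [] ; valid = (() , _) ∷ [] } _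
  increases record { edges = (suc (suc zero) , suc zero) ∷ [] ; valid = (s≤s () , _) ∷ [] } _
  increases record { edges = (suc (suc zero) , suc (suc zero)) ∷ [] ; valid = (s≤s (s≤s ()) , _) ∷ [] } _

P₄-3-critical : Critical P₄ 3
P₄-3-critical = record
  { connected = proj₁ P₄-tree
  ; order≥3   = ℕ.n≤1+n 3
  ; increases = λ F card-F →
      tree⇒γ<γ-subdivide P₄ P₄-tree (ℕ.n≤1+n 3) F (ℕ.≤-reflexive (sym card-F))
  -- Subdividing two edges of `P₄` gives a path on six vertices, whose domination number is still 2;
  -- the final `refl` computes both sides.
  ; sharp     = record
      { edges  = (zero , suc zero) ∷ (suc zero , suc (suc zero)) ∷ []
      ; unique = ((λ ()) ∷ []) ∷ [] ∷ []
      ; valid  = (s≤s z≤n , inj₂ refl) ∷ (s≤s (s≤s z≤n) , inj₂ refl) ∷ []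
      } , refl , refl
  }

corollary3p7 : (∀ (T : Graph) → IsTree T → 3 ≤ order T →
    ∀ (q : ℕ) → 1 ≤ q → Critical T q → 1 ≤ q × q ≤ order T ∸ 1)
    × (Σ Graph λ T → IsTree T × 3 ≤ order T × Critical T 1)
    × (Σ Graph λ T → IsTree T × 3 ≤ order T × Critical T (order T ∸ 1))
corollary3p7 =
  (λ T tree 3≤n q 1≤q critical → 1≤q , critical⇒≤order∸1 T tree 3≤n critical) ,
  (P₃ , P₃-tree , ℕ.≤-refl , P₃-1-critical) ,
  (P₄ , P₄-tree , ℕ.n≤1+n 3 , P₄-3-critical)
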